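{- Let $w\in S_n$, let $C^G(w)$ be the greedy climbing chain of $w$, and let $\xi(w)=(C^G(w),C^G(w))$ be this chain with all links marked. Then $$\mathrm{wt}(\xi(w))=\mathrm{invcode}(w).$$
   Context: Conventions. Permutations are in one-line notation; $t_{ij}$ is the transposition of $i,j$, and $wt_{ij}$ is $w$ with the values in positions $i$ and $j$ exchanged. $w_0\in S_n$ is the longest permutation, $w_0(k)=n+1-k$. The Bruhat order is the transitive closure of $w\le wt_{ij}$ for $i<j$ with $w(i)<w(j)$; $\lessdot$ denotes its cover relation. $[n]=\{1,\ldots,n\}$. Climbing chains. A climbing chain of $w\in S_n$ is a sequence $C=(C_1,\ldots,C_m)$ of pairs (links) $C_p=(i_p,j_p)$ with $i_p<j_p$, $i_1\le\cdots\le i_m$, $wt_{i_1j_1}\cdots t_{i_mj_m}=w_0$, and $wt_{i_1j_1}\cdots t_{i_{p-1}j_{p-1}}\lessdot wt_{i_1j_1}\cdots t_{i_pj_p}$ for each $p\in[m]$. (The only climbing chain of $w_0$ is empty. The links of a chain are distinct, so $C$ is also regarded as a set.) For a chain $C$ and a set $U\subseteq C$ of marked links, $\mathrm{wt}(C,U)\in\mathbb{Z}^n$ is defined by $\mathrm{wt}(C,U)_k=n-k-\#\{\text{links of the form }(k,\star)\text{ in }U\}$ for $k\in[n]$. Greedy chain. For $w\ne w_0$ set $a=\min\{k\mid w(k)\ne n+1-k\}$, $b=w^{ -1}(w(a)+1)$ and $\mathrm{greedy}(w)=(a,b)$. $C^G(w_0)$ is empty; for $w\neq w_0$ with $\mathrm{greedy}(w)=(a,b)$,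 $C^G(w)$ is obtained by prepending $(a,b)$ to $C^G(wt_{ab})$. It is a climbing chain of $w$. $\mathrm{invcode}(w)\in\mathbb{Z}^n$ is the Lehmer code, $\mathrm{invcode}(w)_i=\#\{j>i\mid w(j)<w(i)\}$. -}

module Defs where

open import Data.Empty using (⊥-elim)
open import Data.Fin.Base using (Fin; zero; suc; toℕ; fromℕ<; inject; _<_; _≤_; opposite)
open import Data.Fin.Permutation
  using (Permutation′; _⟨$⟩ʳ_; _⟨$⟩ˡ_; _≈_; _∘ₚ_; transpose; reverse; inverseʳ)
import Data.Fin.Permutation.Components as PC
open import Data.Fin.Properties
  using (_≟_; _<?_; all?; toℕ-fromℕ<; toℕ-inject; toℕ-injective; toℕ<n; opposite-prop;
         opposite-involutive; ¬∀⟶∃¬-smallest)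
open import Data.Integer.Base using (ℤ; +_; _-_)
open import Data.List.Base using (List; []; _∷_; foldl; length; filter; take; allFin)
open import Data.List.Relation.Binary.Sublist.Propositional using (_⊆_; ⊆-refl)
open import Data.List.Relation.Unary.All as All using (All)
open import Data.List.Relation.Unary.Linked as Linked using (Linked)
open import Data.Nat.Base as ℕ using (ℕ; suc; z≤n; s≤s)
open import Data.Nat.Induction using (<-wellFounded)
import Data.Nat.Properties as ℕₚ
open import Data.Nat.Solver using (module +-*-Solver)
open import Data.Product.Base using (∃; ∃₂; _×_; _,_; proj₁; proj₂)
open import Data.Vec.Base using (Vec; tabulate)
import Data.Vec.Functional as F
open import Function.Base using (_∘_)
open import Function.Bundles using (Injection)
open import Function.Properties.Inverse using (↔⇒↣)
open import Induction.WellFounded using (Acc; acc)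
open import Relation.Binary.Construct.Closure.Transitive using (TransClosure; [_]; _∷_; _++_)
open import Relation.Binary.Definitions using (tri<; tri≈; tri>)
open import Relation.Binary.PropositionalEquality hiding (J; [_])
open import Relation.Nullary using (¬_; yes; no)
open import Relation.Nullary.Decidable using (_×-dec_)

-- Positions and values are 0-based: k : Fin n stands for toℕ k + 1 ∈ [n].
-- Permutations are compared by the pointwise equality _≈_.

w₀ : ∀ {n} → Permutation′ n
w₀ = reverse

Link : ℕ → Set
Link n = Fin n × Fin n

-- _∘ₚ_ is diagrammatic: (w · (i , j)) ⟨$⟩ʳ k = w ⟨$⟩ʳ (t_ij k).
infixl 7 _·_ _·*_

_·_ : ∀ {n} → Permutation′ n → Link n → Permutation′ n
w · (i , j) = transpose i j ∘ₚ w

_·*_ : ∀ {n} → Permutation′ n → List (Link n) → Permutation′ n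
w ·* C = foldl _·_ w C

infix 4 _⟶_ _<ᴮ_ _⋖_

_⟶_ : ∀ {n} → Permutation′ n → Permutation′ n → Set
u ⟶ v = ∃₂ λ i j → i < j × u ⟨$⟩ʳ i < u ⟨$⟩ʳ j × v ≈ u · (i , j)

-- The strict Bruhat order (irreflexive, see <ᴮ-irrefl).
_<ᴮ_ : ∀ {n} → Permutation′ n → Permutation′ n → Set
_<ᴮ_ = TransClosure _⟶_

_⋖_ : ∀ {n} → Permutation′ n → Permutation′ n → Set
u ⋖ v = u <ᴮ v × (∀ z → ¬ (u <ᴮ z × z <ᴮ v))

record ClimbingChain {n} (w : Permutation′ n) : Set where
  field
    links  : List (Link n)
    i<j    : All (λ (i , j) → i < j) links
    sorted : Linked (λ (i , _) (i′ , _) → i ≤ i′) links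
    end    : w ·* links ≈ w₀
    covers : ∀ (p : Fin (length links)) →
             w ·* take (toℕ p) links ⋖ w ·* take (suc (toℕ p)) links

open ClimbingChain public

-- The links of a climbing chain are distinct, so its sublists correspond
-- exactly to its subsets.
record MarkedChain {n} (w : Permutation′ n) : Set where
  field
    chain   : ClimbingChain w
    marked  : List (Link n)
    marked⊆ : marked ⊆ links chain

open MarkedChain public

-- suc (toℕ k) is the 1-based position.
wt : ∀ {n} {w : Permutation′ n} → MarkedChain w → Vec ℤ n
wt {n} X = tabulate λ k →
  + n - + suc (toℕ k) - + length (filter (λ (i , _) → i ≟ k) (marked X))

invcode : ∀ {n} → Permutation′ n → Vec ℤ n
invcode {n} w = tabulate λ i →
  + length (filter (λ j → (i <? j) ×-dec (w ⟨$⟩ʳ j <? w ⟨$⟩ʳ i)) (allFin n))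

-- greedy(w) = (a , b); opposite k is the 0-based form of n + 1 - k.
record IsGreedy {n} (w : Permutation′ n) (l : Link n) : Set where
  field
    a-moved : w ⟨$⟩ʳ proj₁ l ≢ opposite (proj₁ l)
    a-least : ∀ k → k < proj₁ l → w ⟨$⟩ʳ k ≡ opposite k
    b-next  : toℕ (w ⟨$⟩ʳ proj₂ l) ≡ suc (toℕ (w ⟨$⟩ʳ proj₁ l))

-- The graph of w ↦ C^G(w); the function itself is greedyLinks.
data Greedy {n} (w : Permutation′ n) : List (Link n) → Set where
  []  : w ≈ w₀ → Greedy w []
  _∷_ : ∀ {l C} → IsGreedy w l → Greedy (w · l) C → Greedy w (l ∷ C)

-- The rest constructs C^G(w) as an actual climbing chain: greedy(w) exists,
-- the recursion terminates, and each greedy link is a Bruhat cover.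
--
-- Both termination and covering use that every Bruhat step strictly decreases
-- Σ_q q · u(q), and weakly decreases Σ_q q · g(u(q)) for every monotone g.

sum : ∀ {n} → (Fin n → ℕ) → ℕ
sum = F.foldr ℕ._+_ 0

sum-cong : ∀ {n} {f g : Fin n → ℕ} → f ≗ g → sum f ≡ sum g
sum-cong {ℕ.zero} e = refl
sum-cong {suc n}  e = cong₂ ℕ._+_ (e zero) (sum-cong (e ∘ suc))

sum-update : ∀ {n} (f g : Fin n → ℕ) i → (∀ k → k ≢ i → f k ≡ g k) →
             sum f ℕ.+ g i ≡ sum g ℕ.+ f i
sum-update f g zero e
  rewrite sum-cong {f = f ∘ suc} {g ∘ suc} (λ k → e (suc k) λ ()) =
  solve 3 (λ x s y → (x :+ s) :+ y := (y :+ s) :+ x) refl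
    (f zero) (sum (g ∘ suc)) (g zero)
  where open +-*-Solver
sum-update f g (suc i) e
  rewrite e zero (λ ()) | ℕₚ.+-assoc (g zero) (sum (f ∘ suc)) (g (suc i))
        | ℕₚ.+-assoc (g zero) (sum (g ∘ suc)) (f (suc i)) =
  cong (g zero ℕ.+_)
    (sum-update (f ∘ suc) (g ∘ suc) i λ k k≢i → e (suc k) λ { refl → k≢i refl })

sum-update₂ : ∀ {n} (f g : Fin n → ℕ) {i j} → i ≢ j →
              (∀ k → k ≢ i → k ≢ j → f k ≡ g k) →
              sum f ℕ.+ (g i ℕ.+ g j) ≡ sum g ℕ.+ (f i ℕ.+ f j)
sum-update₂ f g {i} {j} i≢j e = begin
  sum f ℕ.+ (g i ℕ.+ g j)   ≡⟨ sym (ℕₚ.+-assoc (sum f) (g i) (g j)) ⟩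
  (sum f ℕ.+ g i) ℕ.+ g j   ≡⟨ cong (λ x → sum f ℕ.+ x ℕ.+ g j) (sym hi) ⟩
  (sum f ℕ.+ h i) ℕ.+ g j   ≡⟨ cong (ℕ._+ g j) (sum-update f h i fh) ⟩
  (sum h ℕ.+ f i) ℕ.+ g j   ≡⟨ swap (sum h) (f i) (g j) ⟩
  (sum h ℕ.+ g j) ℕ.+ f i   ≡⟨ cong (ℕ._+ f i) (sum-update h g j hg) ⟩
  (sum g ℕ.+ h j) ℕ.+ f i   ≡⟨ cong (λ x → sum g ℕ.+ x ℕ.+ f i) hj ⟩
  (sum g ℕ.+ f j) ℕ.+ f i   ≡⟨ swap (sum g) (f j) (f i) ⟩
  (sum g ℕ.+ f i) ℕ.+ f j   ≡⟨ ℕₚ.+-assoc (sum g) (f i) (f j) ⟩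
  sum g ℕ.+ (f i ℕ.+ f j)   ∎
  where
  open ≡-Reasoning
  swap : ∀ x y z → x ℕ.+ y ℕ.+ z ≡ x ℕ.+ z ℕ.+ y
  swap = solve 3 (λ x y z → x :+ y :+ z := x :+ z :+ y) refl
    where open +-*-Solver
  h : _ → ℕ
  h k with k ≟ i
  ... | yes _ = g k
  ... | no  _ = f k
  hi : h i ≡ g i
  hi with i ≟ i
  ... | yes _  = refl
  ... | no i≢i = ⊥-elim (i≢i refl)
  hj : h j ≡ f j
  hj with j ≟ i
  ... | yes j≡i = ⊥-elim (i≢j (sym j≡i))
  ... | no  _   = refl
  fh : ∀ k → k ≢ i → f k ≡ h k
  fh k k≢i with k ≟ i
  ... | yes k≡i = ⊥-elim (k≢i k≡i)
  ... | no  _   = refl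
  hg : ∀ k → k ≢ j → h k ≡ g k
  hg k k≢j with k ≟ i
  ... | yes _  = refl
  ... | no k≢i = e k k≢i k≢j

transpose-i : ∀ {n} (i j : Fin n) → PC.transpose i j i ≡ j
transpose-i i j with i ≟ i
... | yes _  = refl
... | no i≢i = ⊥-elim (i≢i refl)

transpose-j : ∀ {n} (i j : Fin n) → PC.transpose i j j ≡ i
transpose-j i j with j ≟ i
... | yes j≡i = j≡i
... | no _ with j ≟ j
...   | yes _  = refl
...   | no j≢j = ⊥-elim (j≢j refl)

transpose-k : ∀ {n} (i j k : Fin n) → k ≢ i → k ≢ j → PC.transpose i j k ≡ k
transpose-k i j k k≢i k≢j with k ≟ i
... | yes k≡i = ⊥-elim (k≢i k≡i)
... | no _ with k ≟ j
...   | yes k≡j = ⊥-elim (k≢j k≡j)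
...   | no _    = refl

potential : ∀ {n} → (ℕ → ℕ) → Permutation′ n → ℕ
potential g u = sum λ q → toℕ q ℕ.* g (toℕ (u ⟨$⟩ʳ q))

potential-≈ : ∀ {n} g {u v : Permutation′ n} → u ≈ v → potential g u ≡ potential g v
potential-≈ g e = sum-cong λ q → cong (λ x → toℕ q ℕ.* g (toℕ x)) (e q)

Monotone : (ℕ → ℕ) → Set
Monotone g = ∀ {x y} → x ℕ.≤ y → g x ℕ.≤ g y

rearrange : ∀ {i j x y} → i ℕ.≤ j → x ℕ.≤ y →
            (i ℕ.* y ℕ.+ j ℕ.* x) ℕ.+ (j ℕ.∸ i) ℕ.* (y ℕ.∸ x) ≡ i ℕ.* x ℕ.+ j ℕ.* y
rearrange {i} {j} {x} {y} i≤j x≤y =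
  subst₂ (λ J Y → (i ℕ.* Y ℕ.+ J ℕ.* x) ℕ.+ d ℕ.* e ≡ i ℕ.* x ℕ.+ J ℕ.* Y)
    (ℕₚ.m+[n∸m]≡n i≤j) (ℕₚ.m+[n∸m]≡n x≤y)
    (solve 4 (λ i x d e → (i :* (x :+ e) :+ (i :+ d) :* x) :+ d :* e
                       := i :* x :+ (i :+ d) :* (x :+ e)) refl i x d e)
  where
  open +-*-Solver
  d = j ℕ.∸ i
  e = y ℕ.∸ x

potential-swap : ∀ {n g} → Monotone g → (u : Permutation′ n) {i j : Fin n} → i < j →
  toℕ (u ⟨$⟩ʳ i) ℕ.≤ toℕ (u ⟨$⟩ʳ j) →
  potential g (u · (i , j))
    ℕ.+ (toℕ j ℕ.∸ toℕ i) ℕ.* (g (toℕ (u ⟨$⟩ʳ j)) ℕ.∸ g (toℕ (u ⟨$⟩ʳ i)))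
    ≡ potential g u
potential-swap {g = g} mono u {i} {j} i<j ui≤uj =
  ℕₚ.+-cancelʳ-≡ (I ℕ.* Y ℕ.+ J ℕ.* X) _ _ (begin
    pv ℕ.+ D ℕ.+ (I ℕ.* Y ℕ.+ J ℕ.* X)   ≡⟨ move pv D (I ℕ.* Y ℕ.+ J ℕ.* X) ⟩
    pv ℕ.+ (I ℕ.* Y ℕ.+ J ℕ.* X ℕ.+ D)   ≡⟨ cong (pv ℕ.+_) (rearrange (ℕₚ.<⇒≤ i<j) (mono ui≤uj)) ⟩
    pv ℕ.+ (I ℕ.* X ℕ.+ J ℕ.* Y)         ≡⟨ sum-update₂ f _ i≢j off ⟩
    potential g u ℕ.+ (f i ℕ.+ f j)      ≡⟨ cong₂ (λ a b → potential g u ℕ.+ (I ℕ.* val a ℕ.+ J ℕ.* val b))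
                                              (transpose-i i j) (transpose-j i j) ⟩
    potential g u ℕ.+ (I ℕ.* Y ℕ.+ J ℕ.* X) ∎)
  where
  open ≡-Reasoning
  val : _ → ℕ
  val k = g (toℕ (u ⟨$⟩ʳ k))
  f : _ → ℕ
  f k = toℕ k ℕ.* val (PC.transpose i j k)
  I = toℕ i
  J = toℕ j
  X = val i
  Y = val j
  D = (J ℕ.∸ I) ℕ.* (Y ℕ.∸ X)
  pv = potential g (u · (i , j))
  i≢j : i ≢ j
  i≢j refl = ℕₚ.<-irrefl refl i<j
  off : ∀ k → k ≢ i → k ≢ j → f k ≡ toℕ k ℕ.* val k
  off k k≢i k≢j = cong (λ x → toℕ k ℕ.* val x) (transpose-k i j k k≢i k≢j)
  move : ∀ p d s → p ℕ.+ d ℕ.+ s ≡ p ℕ.+ (s ℕ.+ d)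
  move = solve 3 (λ p d s → p :+ d :+ s := p :+ (s :+ d)) refl
    where open +-*-Solver

potential-swap-< : ∀ {n g} → Monotone g → (u : Permutation′ n) {i j : Fin n} → i < j →
  toℕ (u ⟨$⟩ʳ i) ℕ.≤ toℕ (u ⟨$⟩ʳ j) → g (toℕ (u ⟨$⟩ʳ i)) ℕ.< g (toℕ (u ⟨$⟩ʳ j)) →
  potential g (u · (i , j)) ℕ.< potential g u
potential-swap-< mono u i<j ui≤uj gui<guj =
  ℕₚ.<-≤-trans
    (ℕₚ.m<m+n _ (ℕₚ.*-mono-< (ℕₚ.m<n⇒0<n∸m i<j) (ℕₚ.m<n⇒0<n∸m gui<guj)))
    (ℕₚ.≤-reflexive (potential-swap mono u i<j ui≤uj))

⟶-potential-≤ : ∀ {n g} → Monotone g → {u v : Permutation′ n} → u ⟶ v →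
                potential g v ℕ.≤ potential g u
⟶-potential-≤ {g = g} mono {u} {v} (i , j , i<j , ui<uj , e) =
  ℕₚ.≤-trans (ℕₚ.≤-reflexive (potential-≈ g {v} {u · (i , j)} e))
    (ℕₚ.≤-trans (ℕₚ.m≤m+n _ _)
      (ℕₚ.≤-reflexive (potential-swap mono u i<j (ℕₚ.<⇒≤ ui<uj))))

⟶-potential-< : ∀ {n} {u v : Permutation′ n} → u ⟶ v →
                potential (λ x → x) v ℕ.< potential (λ x → x) u
⟶-potential-< {u = u} {v} (i , j , i<j , ui<uj , e) =
  ℕₚ.≤-<-trans (ℕₚ.≤-reflexive (potential-≈ (λ x → x) {v} {u · (i , j)} e))
    (potential-swap-< (λ x≤y → x≤y) u i<j (ℕₚ.<⇒≤ ui<uj) ui<uj)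

<ᴮ-potential-≤ : ∀ {n g} → Monotone g → {u v : Permutation′ n} → u <ᴮ v →
                 potential g v ℕ.≤ potential g u
<ᴮ-potential-≤ mono {u} {v} [ s ] = ⟶-potential-≤ mono {u} {v} s
<ᴮ-potential-≤ mono {u} {v} (_∷_ {y = z} s ss) =
  ℕₚ.≤-trans (<ᴮ-potential-≤ mono {z} {v} ss) (⟶-potential-≤ mono {u} {z} s)

<ᴮ-potential-< : ∀ {n} {u v : Permutation′ n} → u <ᴮ v →
                 potential (λ x → x) v ℕ.< potential (λ x → x) u
<ᴮ-potential-< {u = u} {v} [ s ] = ⟶-potential-< {u = u} {v} s
<ᴮ-potential-< {u = u} {v} (_∷_ {y = z} s ss) =
  ℕₚ.<-trans (<ᴮ-potential-< {u = z} {v} ss) (⟶-potential-< {u = u} {z} s)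

<ᴮ-irrefl : ∀ {n} {u v : Permutation′ n} → u ≈ v → ¬ (u <ᴮ v)
<ᴮ-irrefl {u = u} {v} e u<v = ℕₚ.<-irrefl (sym (potential-≈ (λ x → x) {u} {v} e)) (<ᴮ-potential-< u<v)

⟨$⟩ʳ-injective : ∀ {n} (w : Permutation′ n) {i j} → w ⟨$⟩ʳ i ≡ w ⟨$⟩ʳ j → i ≡ j
⟨$⟩ʳ-injective w = Injection.injective (↔⇒↣ w)

adjacent-⋖ : ∀ {n} (w : Permutation′ n) {a b : Fin n} → a < b →
             toℕ (w ⟨$⟩ʳ b) ≡ suc (toℕ (w ⟨$⟩ʳ a)) → w ⋖ w · (a , b)
adjacent-⋖ {n} w {a} {b} a<b wb≡1+wa =
  [ a , b , a<b , ℕₚ.≤-reflexive (sym wb≡1+wa) , (λ _ → refl) ] , between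
  where
  v = w · (a , b)
  wa≤wb : toℕ (w ⟨$⟩ʳ a) ℕ.≤ toℕ (w ⟨$⟩ʳ b)
  wa≤wb = ℕₚ.≤-trans (ℕₚ.n≤1+n _) (ℕₚ.≤-reflexive (sym wb≡1+wa))

  first : ∀ {z} → w ⟶ z → ¬ (z <ᴮ v)
  first {z} (i , j , i<j , wi<wj , z≈) z<v = <ᴮ-irrefl {u = z} {v} z≈v z<v
    where
    A = toℕ (w ⟨$⟩ʳ a)
    B = toℕ (w ⟨$⟩ʳ b)
    X = toℕ (w ⟨$⟩ʳ i)
    Y = toℕ (w ⟨$⟩ʳ j)

    separates : ∀ g → Monotone g → g X ℕ.< g Y → g A ≢ g B
    separates g mono gX<gY gA≡gB = ℕₚ.<-irrefl same
      (ℕₚ.≤-<-trans (<ᴮ-potential-≤ mono z<v)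
        (ℕₚ.≤-<-trans (ℕₚ.≤-reflexive (potential-≈ g {z} {w · (i , j)} z≈))
          (potential-swap-< mono w i<j (ℕₚ.<⇒≤ wi<wj) gX<gY)))
      where
      open ≡-Reasoning
      same : potential g v ≡ potential g w
      same = begin
        potential g v
          ≡⟨ sym (ℕₚ.+-identityʳ _) ⟩
        potential g v ℕ.+ 0
          ≡⟨ cong (potential g v ℕ.+_) (sym (ℕₚ.*-zeroʳ (toℕ b ℕ.∸ toℕ a))) ⟩
        potential g v ℕ.+ (toℕ b ℕ.∸ toℕ a) ℕ.* 0
          ≡⟨ cong (λ x → potential g v ℕ.+ (toℕ b ℕ.∸ toℕ a) ℕ.* x)
               (sym (trans (cong (g B ℕ.∸_) gA≡gB) (ℕₚ.n∸n≡0 (g B)))) ⟩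
        potential g v ℕ.+ (toℕ b ℕ.∸ toℕ a) ℕ.* (g B ℕ.∸ g A)
          ≡⟨ potential-swap mono w a<b wa≤wb ⟩
        potential g w ∎

    A≤X : A ℕ.≤ X
    A≤X = ℕₚ.≮⇒≥ λ X<A → separates (ℕ._⊓ A) (ℕₚ.⊓-monoˡ-≤ A)
      (ℕₚ.≤-<-trans (ℕₚ.m⊓n≤m X A) (ℕₚ.⊓-pres-m< wi<wj X<A))
      (trans (ℕₚ.m≤n⇒m⊓n≡m ℕₚ.≤-refl) (sym (ℕₚ.m≥n⇒m⊓n≡n wa≤wb)))

    Y≤B : Y ℕ.≤ B
    Y≤B = ℕₚ.≮⇒≥ λ B<Y → separates (ℕ._⊔ B) (ℕₚ.⊔-monoˡ-≤ B)
      (ℕₚ.<-≤-trans (ℕₚ.⊔-pres-<m wi<wj B<Y) (ℕₚ.m≤m⊔n Y B))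
      (trans (ℕₚ.m≤n⇒m⊔n≡n wa≤wb) (sym (ℕₚ.m≤n⇒m⊔n≡n ℕₚ.≤-refl)))

    X≤A : X ℕ.≤ A
    X≤A = ℕₚ.≤-pred (ℕₚ.≤-trans wi<wj (ℕₚ.≤-trans Y≤B (ℕₚ.≤-reflexive wb≡1+wa)))

    B≤Y : B ℕ.≤ Y
    B≤Y = ℕₚ.≤-trans (ℕₚ.≤-reflexive wb≡1+wa) (ℕₚ.≤-trans (s≤s A≤X) wi<wj)

    i≡a : i ≡ a
    i≡a = ⟨$⟩ʳ-injective w (toℕ-injective (ℕₚ.≤-antisym X≤A A≤X))

    j≡b : j ≡ b
    j≡b = ⟨$⟩ʳ-injective w (toℕ-injective (ℕₚ.≤-antisym Y≤B B≤Y))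

    z≈v : z ≈ v
    z≈v = subst₂ (λ i j → z ≈ w · (i , j)) i≡a j≡b z≈

  between : ∀ z → ¬ (w <ᴮ z × z <ᴮ v)
  between z ([ s ] , z<v)    = first s z<v
  between z (s ∷ ss , z<v)   = first s (ss ++ z<v)


opposite-toℕ : ∀ {n} (i : Fin n) → suc (toℕ (opposite i) ℕ.+ toℕ i) ≡ n
opposite-toℕ {n} i =
  trans (sym (ℕₚ.+-suc _ (toℕ i)))
    (trans (cong (ℕ._+ suc (toℕ i)) (opposite-prop i)) (ℕₚ.m∸n+n≡m (toℕ<n i)))

module _ {n} {w : Permutation′ n} where

  greedy-a<b : ∀ {l} → IsGreedy w l → proj₁ l < proj₂ l
  greedy-a<b {a , b} G with ℕₚ.<-cmp (toℕ a) (toℕ b)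
  ... | tri< a<b _ _ = a<b
  ... | tri≈ _ a≡b _ = ⊥-elim (ℕₚ.1+n≢n (trans (sym b-next)
                         (cong (λ k → toℕ (w ⟨$⟩ʳ k)) (sym (toℕ-injective a≡b)))))
    where open IsGreedy G
  ... | tri> _ _ b<a = ⊥-elim (no-c c-cmp)
    where
    open IsGreedy G
    1+b<n : suc (toℕ b) ℕ.< n
    1+b<n = ℕₚ.≤-<-trans b<a (toℕ<n a)
    c : Fin n
    c = fromℕ< 1+b<n
    c-toℕ : toℕ c ≡ suc (toℕ b)
    c-toℕ = toℕ-fromℕ< 1+b<n
    opp-c : toℕ (opposite c) ≡ toℕ (w ⟨$⟩ʳ a)
    opp-c = ℕₚ.suc-injective (ℕₚ.+-cancelʳ-≡ (toℕ b) _ _ (ℕₚ.suc-injective (begin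
      suc (suc (toℕ (opposite c)) ℕ.+ toℕ b)   ≡⟨ cong suc (sym (ℕₚ.+-suc _ (toℕ b))) ⟩
      suc (toℕ (opposite c) ℕ.+ suc (toℕ b))   ≡⟨ cong (λ x → suc (toℕ (opposite c) ℕ.+ x)) (sym c-toℕ) ⟩
      suc (toℕ (opposite c) ℕ.+ toℕ c)         ≡⟨ opposite-toℕ c ⟩
      n                                        ≡⟨ sym (opposite-toℕ b) ⟩
      suc (toℕ (opposite b) ℕ.+ toℕ b)         ≡⟨ cong (λ x → suc (toℕ x ℕ.+ toℕ b)) (sym (a-least b b<a)) ⟩
      suc (toℕ (w ⟨$⟩ʳ b) ℕ.+ toℕ b)           ≡⟨ cong (λ x → suc (x ℕ.+ toℕ b)) b-next ⟩
      suc (suc (toℕ (w ⟨$⟩ʳ a)) ℕ.+ toℕ b)     ∎)))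
      where open ≡-Reasoning
    c-cmp : toℕ c ℕ.≤ toℕ a
    c-cmp = ℕₚ.≤-trans (ℕₚ.≤-reflexive c-toℕ) b<a
    no-c : ¬ (toℕ c ℕ.≤ toℕ a)
    no-c c≤a with c ≟ a
    ... | yes c≡a = a-moved (sym (trans (cong opposite (sym c≡a)) (toℕ-injective opp-c)))
    ... | no  c≢a = c≢a (⟨$⟩ʳ-injective w (trans
            (a-least c (ℕₚ.≤∧≢⇒< c≤a (c≢a ∘ toℕ-injective))) (toℕ-injective opp-c)))

  greedy-⟶ : ∀ {l} → IsGreedy w l → w ⟶ w · l
  greedy-⟶ {a , b} G = a , b , greedy-a<b G ,
    ℕₚ.≤-reflexive (sym (IsGreedy.b-next G)) , λ _ → refl

  greedy-⋖ : ∀ {l} → IsGreedy w l → w ⋖ w · l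
  greedy-⋖ G = adjacent-⋖ w (greedy-a<b G) (IsGreedy.b-next G)

  greedy-sorted : ∀ {l l′} → IsGreedy w l → IsGreedy (w · l) l′ → proj₁ l ≤ proj₁ l′
  greedy-sorted {a , b} {a′ , b′} G G′ = ℕₚ.≮⇒≥ λ a′<a →
    IsGreedy.a-moved G′ (trans
      (cong (w ⟨$⟩ʳ_) (transpose-k a b a′
        (λ { refl → ℕₚ.<-irrefl refl a′<a })
        (λ { refl → ℕₚ.<-asym a′<a (greedy-a<b G) })))
      (IsGreedy.a-least G a′ a′<a))

greedy : ∀ {n} (w : Permutation′ n) → ¬ (w ≈ w₀) → ∃ (IsGreedy w)
greedy {n} w w≉w₀ with ¬∀⟶∃¬-smallest n _ (λ k → w ⟨$⟩ʳ k ≟ opposite k) w≉w₀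
... | a , moved , least = (a , w ⟨$⟩ˡ next) , record
  { a-moved = moved
  ; a-least = least′
  ; b-next  = trans (cong toℕ (inverseʳ w)) (toℕ-fromℕ< 1+wa<n)
  }
  where
  least′ : ∀ k → k < a → w ⟨$⟩ʳ k ≡ opposite k
  least′ k k<a = subst (λ k → w ⟨$⟩ʳ k ≡ opposite k)
    (toℕ-injective (trans (toℕ-inject (fromℕ< k<a)) (toℕ-fromℕ< k<a)))
    (least (fromℕ< k<a))
  o = opposite (w ⟨$⟩ʳ a)
  a≤o : toℕ a ℕ.≤ toℕ o
  a≤o = ℕₚ.≮⇒≥ λ o<a → ℕₚ.<-irrefl
    (cong toℕ (⟨$⟩ʳ-injective w (trans (least′ o o<a) (opposite-involutive (w ⟨$⟩ʳ a))))) o<a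
  a<o : toℕ a ℕ.< toℕ o
  a<o = ℕₚ.≤∧≢⇒< a≤o λ a≡o → moved (trans (sym (opposite-involutive (w ⟨$⟩ʳ a)))
    (cong opposite (sym (toℕ-injective a≡o))))
  1+wa<n : suc (toℕ (w ⟨$⟩ʳ a)) ℕ.< n
  1+wa<n = subst (suc (toℕ (w ⟨$⟩ʳ a)) ℕ.<_) (opposite-toℕ (w ⟨$⟩ʳ a))
    (s≤s (ℕₚ.m<n+m _ (ℕₚ.≤-<-trans z≤n a<o)))
  next : Fin n
  next = fromℕ< 1+wa<n

greedyChain-acc : ∀ {n} (w : Permutation′ n) → Acc ℕ._<_ (potential (λ x → x) w) → ∃ (Greedy w)
greedyChain-acc w (acc rs) with all? (λ k → w ⟨$⟩ʳ k ≟ opposite k)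
... | yes w≈w₀ = [] , [] w≈w₀
... | no  w≉w₀ with greedy w w≉w₀
...   | l , G with greedyChain-acc (w · l) (rs (⟶-potential-< {u = w} {w · l} (greedy-⟶ {l = l} G)))
...     | C , GC = l ∷ C , G ∷ GC

greedyLinks : ∀ {n} → Permutation′ n → List (Link n)
greedyLinks w = proj₁ (greedyChain-acc w (<-wellFounded _))

greedyLinks-Greedy : ∀ {n} (w : Permutation′ n) → Greedy w (greedyLinks w)
greedyLinks-Greedy w = proj₂ (greedyChain-acc w (<-wellFounded _))

Greedy⇒Climbing : ∀ {n} {w : Permutation′ n} {C} → Greedy w C → ClimbingChain w
Greedy⇒Climbing {n} {w} {C} GC = record
  { links = C ; i<j = increasing GC ; sorted = sort GC ; end = ends GC ; covers = cov GC }
  where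
  increasing : ∀ {u : Permutation′ n} {C} → Greedy u C → All (λ (i , j) → i < j) C
  increasing ([] _)   = All.[]
  increasing (G ∷ GC) = greedy-a<b G All.∷ increasing GC

  sort : ∀ {u : Permutation′ n} {C} → Greedy u C → Linked (λ (i , _) (i′ , _) → i ≤ i′) C
  sort ([] _)             = Linked.[]
  sort (G ∷ [] _)         = Linked.[-]
  sort (G ∷ GC@(G′ ∷ _))  = greedy-sorted G G′ Linked.∷ sort GC

  ends : ∀ {u : Permutation′ n} {C} → Greedy u C → u ·* C ≈ w₀
  ends ([] e)   = e
  ends (_ ∷ GC) = ends GC

  cov : ∀ {u : Permutation′ n} {C} → Greedy u C → (p : Fin (length C)) →
        u ·* take (toℕ p) C ⋖ u ·* take (suc (toℕ p)) C
  cov (G ∷ GC) zero    = greedy-⋖ G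
  cov (G ∷ GC) (suc p) = cov GC p

Cᴳ : ∀ {n} (w : Permutation′ n) → ClimbingChain w
Cᴳ w = Greedy⇒Climbing (greedyLinks-Greedy w)

ξ : ∀ {n} (w : Permutation′ n) → MarkedChain w
ξ w = record { chain = Cᴳ w ; marked = links (Cᴳ w) ; marked⊆ = ⊆-refl }

{-# OPTIONS --safe #-}

-- For every position k, the number of links (k , ⋆) of a greedy chain plus the
-- k-th entry of the Lehmer code equals n − k, by induction along the chain.
-- A greedy link (a , b) exchanges the adjacent values w(a) and w(a) + 1, so it
-- changes the relative order of the entries in positions a and b only: it
-- raises entry a of the code by one and fixes the other entries. The code of w₀
-- at k is n − k.

module Submission where

open import Defs
open import Data.Bool.Base using (if_then_else_)
open import Data.Empty using (⊥-elim)
open import Data.Fin.Base using (Fin; zero; suc; toℕ; opposite; _<_)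
open import Data.Fin.Permutation using (Permutation′; _⟨$⟩ʳ_; _≈_)
open import Data.Fin.Properties
  using (_≟_; _<?_; toℕ-injective; toℕ<n; opposite-prop; <-irrefl; <-asym)
open import Data.Integer.Base using (+_; _-_)
import Data.Integer.Properties as ℤₚ
open import Data.Integer.Solver using (module +-*-Solver)
open import Data.List.Base using (List; length; filter; tabulate; allFin; []; _∷_)
open import Data.List.Properties using (filter-accept; filter-reject)
open import Data.Nat.Base as ℕ using (ℕ; suc; s≤s)
import Data.Nat.Properties as ℕₚ
open import Data.Product.Base using (_×_; _,_; proj₁)
open import Data.Vec.Properties using (tabulate-cong)
open import Function.Base using (id; _∘_)
open import Function.Bundles using (_⇔_; mk⇔; Equivalence)
import Function.Properties.Equivalence as ⇔
open import Relation.Binary.PropositionalEquality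
open import Relation.Nullary using (¬_)
open import Relation.Nullary.Decidable
  using (Dec; yes; no; does; _×-dec_; does-⇔; dec-true; dec-false)
open import Relation.Unary using (Pred; Decidable)

indicator : ∀ {p} {P : Set p} → Dec P → ℕ
indicator P? = if does P? then 1 else 0

indicator-⇔ : ∀ {p q} {P : Set p} {Q : Set q} → P ⇔ Q → (P? : Dec P) (Q? : Dec Q) →
              indicator P? ≡ indicator Q?
indicator-⇔ P⇔Q P? Q? = cong (if_then 1 else 0) (does-⇔ P⇔Q P? Q?)

-- Lets `sum-cong` and `sum-update` act on Lehmer code entries, which are given as lengths of
-- filtered lists.
length-filter-tabulate : ∀ {a p n} {A : Set a} {P : Pred A p} (P? : Decidable P) (f : Fin n → A) →
                         length (filter P? (tabulate f)) ≡ sum (λ i → indicator (P? (f i)))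
length-filter-tabulate {n = ℕ.zero} P? f = refl
length-filter-tabulate {n = suc n}  P? f with P? (f zero)
... | yes _ = cong suc (length-filter-tabulate P? (f ∘ suc))
... | no  _ = length-filter-tabulate P? (f ∘ suc)

sum-one : ∀ n → sum {n} (λ _ → 1) ≡ n
sum-one ℕ.zero  = refl
sum-one (suc n) = cong suc (sum-one n)

-- The positions after k and the `suc (toℕ k)` positions up to k exhaust all n. The additive form
-- avoids truncated subtraction.
sum-greater : ∀ {n} (k : Fin n) → sum {n} (λ j → indicator (k <? j)) ℕ.+ suc (toℕ k) ≡ n
sum-greater {suc n} zero    = trans (ℕₚ.+-comm (sum {n} λ _ → 1) 1) (cong suc (sum-one n))
sum-greater {suc n} (suc k) = trans (ℕₚ.+-suc (sum {n} λ j → indicator (k <? j)) _) (cong suc (sum-greater k))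

opposite-anti-< : ∀ {n} {i j : Fin n} → i < j → opposite j < opposite i
opposite-anti-< {n} {i} {j} i<j =
  subst₂ ℕ._<_ (sym (opposite-prop j)) (sym (opposite-prop i))
    (ℕₚ.∸-monoʳ-< (s≤s i<j) (toℕ<n j))

inversion? : ∀ {n} (w : Permutation′ n) (k j : Fin n) → Dec (k < j × w ⟨$⟩ʳ j < w ⟨$⟩ʳ k)
inversion? w k j = (k <? j) ×-dec (w ⟨$⟩ʳ j <? w ⟨$⟩ʳ k)

code : ∀ {n} → Permutation′ n → Fin n → ℕ
code w k = sum λ j → indicator (inversion? w k j)

-- Since `w₀` is decreasing, every position after k forms an inversion with k.
code-w₀ : ∀ {n} {w : Permutation′ n} → w ≈ w₀ → ∀ k → code w k ℕ.+ suc (toℕ k) ≡ n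
code-w₀ {w = w} w≈w₀ k = trans
  (cong (ℕ._+ suc (toℕ k)) (sum-cong λ j →
    indicator-⇔ (mk⇔ proj₁ λ k<j → k<j , descends k<j) (inversion? w k j) (k <? j)))
  (sum-greater k)
  where
  descends : ∀ {j} → k < j → w ⟨$⟩ʳ j < w ⟨$⟩ʳ k
  descends {j} k<j = subst₂ _<_ (sym (w≈w₀ j)) (sym (w≈w₀ k)) (opposite-anti-< k<j)

module _ {n} (w : Permutation′ n) {a b : Fin n} (a<b : a < b)
         (wb≡1+wa : toℕ (w ⟨$⟩ʳ b) ≡ suc (toℕ (w ⟨$⟩ʳ a))) where

  private
    value : Fin n → ℕ
    value k = toℕ (w ⟨$⟩ʳ k)

    value-≢ : ∀ {i j} → i ≢ j → value i ≢ value j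
    value-≢ i≢j = i≢j ∘ ⟨$⟩ʳ-injective w ∘ toℕ-injective

    value′ : Fin n → ℕ
    value′ k = toℕ ((w · (a , b)) ⟨$⟩ʳ k)

    value′-a : value′ a ≡ value b
    value′-a = cong value (transpose-i a b)

    value′-b : value′ b ≡ value a
    value′-b = cong value (transpose-j a b)

    value′-k : ∀ {k} → k ≢ a → k ≢ b → value′ k ≡ value k
    value′-k k≢a k≢b = cong value (transpose-k a b _ k≢a k≢b)

    wa<wb : value a ℕ.< value b
    wa<wb = ℕₚ.≤-reflexive (sym wb≡1+wa)

  -- No value lies strictly between w(a) and w(b) = w(a) + 1, and injectivity keeps w(k) from being
  -- equal to w(a).
  below-adjacent : ∀ {k} → k ≢ a → value k ℕ.< value b ⇔ value k ℕ.< value a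
  below-adjacent {k} k≢a = mk⇔
    (λ k<b → ℕₚ.≤∧≢⇒< (ℕₚ.≤-pred (subst (value k ℕ.<_) wb≡1+wa k<b)) (value-≢ k≢a))
    (λ k<a → ℕₚ.<-trans k<a wa<wb)

  above-adjacent : ∀ {k} → k ≢ b → value b ℕ.< value k ⇔ value a ℕ.< value k
  above-adjacent {k} k≢b = mk⇔
    (ℕₚ.<-trans wa<wb)
    (λ a<k → ℕₚ.≤∧≢⇒< (subst (ℕ._≤ value k) (sym wb≡1+wa) a<k) (value-≢ (k≢b ∘ sym)))

  -- Any pair k < j other than (a , b) has a member outside {a , b}, whose value compares alike with
  -- w(a) and w(b).
  adjacent-swap-inversion : ∀ k j → ¬ (k ≡ a × j ≡ b) →
    (k < j × (w · (a , b)) ⟨$⟩ʳ j < (w · (a , b)) ⟨$⟩ʳ k) ⇔ (k < j × w ⟨$⟩ʳ j < w ⟨$⟩ʳ k)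
  adjacent-swap-inversion k j ≢ab = mk⇔
    (λ (k<j , lt) → k<j , Equivalence.to   (order k<j) lt)
    (λ (k<j , lt) → k<j , Equivalence.from (order k<j) lt)
    where
    moved : ∀ {x y} → value′ j ≡ x → value′ k ≡ y →
            x ℕ.< y ⇔ value j ℕ.< value k → value′ j ℕ.< value′ k ⇔ value j ℕ.< value k
    moved refl refl e = e

    cases : k < j → Dec (k ≡ a) → Dec (k ≡ b) → Dec (j ≡ a) → Dec (j ≡ b) →
            value′ j ℕ.< value′ k ⇔ value j ℕ.< value k
    -- With both positions in {a , b}, either k < j fails, by a < b when k = b and j = a, or the
    -- pair is the excluded one.
    cases k<j (yes refl) _          (yes refl) _          = ⊥-elim (<-irrefl refl k<j)
    cases k<j (yes refl) _          (no _)     (yes refl) = ⊥-elim (≢ab (refl , refl))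
    cases k<j (yes refl) _          (no j≢a)   (no j≢b)   =
      moved (value′-k j≢a j≢b) value′-a (below-adjacent j≢a)
    cases k<j (no _)     (yes refl) (yes refl) _          = ⊥-elim (<-asym k<j a<b)
    cases k<j (no _)     (yes refl) (no _)     (yes refl) = ⊥-elim (<-irrefl refl k<j)
    cases k<j (no _)     (yes refl) (no j≢a)   (no j≢b)   =
      moved (value′-k j≢a j≢b) value′-b (⇔.sym (below-adjacent j≢a))
    cases k<j (no k≢a)   (no k≢b)   (yes refl) _          =
      moved value′-a (value′-k k≢a k≢b) (above-adjacent k≢b)
    cases k<j (no k≢a)   (no k≢b)   (no _)     (yes refl) =
      moved value′-b (value′-k k≢a k≢b) (⇔.sym (above-adjacent k≢b))
    cases k<j (no k≢a)   (no k≢b)   (no j≢a)   (no j≢b)   =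
      moved (value′-k j≢a j≢b) (value′-k k≢a k≢b) ⇔.refl

    order : k < j → value′ j ℕ.< value′ k ⇔ value j ℕ.< value k
    order k<j = cases k<j (k ≟ a) (k ≟ b) (j ≟ a) (j ≟ b)

  -- The exceptional pair (a , b) counts only towards entry a, so even entry b is unchanged,
  -- although the value there drops.
  code-adjacent-swap : ∀ {k} → k ≢ a → code (w · (a , b)) k ≡ code w k
  code-adjacent-swap {k} k≢a = sum-cong λ j →
    indicator-⇔ (adjacent-swap-inversion k j (k≢a ∘ proj₁))
      (inversion? (w · (a , b)) k j) (inversion? w k j)

  -- Only the term at b changes: (a , b) is not an inversion before the swap and is one after it.
  code-adjacent-swap-a : code (w · (a , b)) a ≡ suc (code w a)
  code-adjacent-swap-a = begin
    code (w · (a , b)) a         ≡⟨ ℕₚ.+-identityʳ _ ⟨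
    -- The added 0 is the old term at b, as `sum-update` exchanges the differing terms across the
    -- equation instead of subtracting.
    code (w · (a , b)) a ℕ.+ 0   ≡⟨ cong (code (w · (a , b)) a ℕ.+_) old-b ⟨
    code (w · (a , b)) a ℕ.+ old b
      ≡⟨ sum-update new old b (λ j j≢b →
           indicator-⇔ (adjacent-swap-inversion a j λ (_ , j≡b) → j≢b j≡b)
             (inversion? (w · (a , b)) a j) (inversion? w a j)) ⟩
    code w a ℕ.+ new b           ≡⟨ cong (code w a ℕ.+_) new-b ⟩
    code w a ℕ.+ 1               ≡⟨ ℕₚ.+-comm (code w a) 1 ⟩
    suc (code w a)               ∎
    where
    open ≡-Reasoning
    new old : Fin n → ℕ
    new j = indicator (inversion? (w · (a , b)) a j)
    old j = indicator (inversion? w a j)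
    new-b : new b ≡ 1
    new-b = cong (if_then 1 else 0) (dec-true (inversion? (w · (a , b)) a b)
      (a<b , subst₂ ℕ._<_ (sym value′-b) (sym value′-a) wa<wb))
    old-b : old b ≡ 0
    old-b = cong (if_then 1 else 0) (dec-false (inversion? w a b)
      λ (_ , wb<wa) → ℕₚ.<-asym wa<wb wb<wa)

linksAt : ∀ {n} → List (Link n) → Fin n → ℕ
linksAt C k = length (filter (λ (i , _) → i ≟ k) C)

greedy-linksAt-code : ∀ {n} {w : Permutation′ n} {C} → Greedy w C → ∀ k →
                      linksAt C k ℕ.+ (code w k ℕ.+ suc (toℕ k)) ≡ n
greedy-linksAt-code {w = w} ([] w≈w₀) k = code-w₀ {w = w} w≈w₀ k
greedy-linksAt-code {n} {w} (_∷_ {a , b} {C} G GC) k = step (a ≟ k)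
  where
  open ≡-Reasoning
  P? : Decidable (λ (l : Link n) → proj₁ l ≡ k)
  P? (i , _) = i ≟ k
  a<b = greedy-a<b {w = w} G
  b-next = IsGreedy.b-next G
  step : Dec (a ≡ k) → linksAt ((a , b) ∷ C) k ℕ.+ (code w k ℕ.+ suc (toℕ k)) ≡ n
  step (yes refl) = begin
    linksAt ((a , b) ∷ C) a ℕ.+ (code w a ℕ.+ suc (toℕ a))
      ≡⟨ cong (λ xs → length xs ℕ.+ (code w a ℕ.+ suc (toℕ a))) (filter-accept P? {a , b} {C} refl) ⟩
    suc (linksAt C a ℕ.+ (code w a ℕ.+ suc (toℕ a)))
      -- The unit contributed by the link (a , b) becomes the unit by which the swap raises entry a,
      -- which leaves the induction hypothesis for `w · (a , b)`.
      ≡⟨ ℕₚ.+-suc (linksAt C a) _ ⟨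
    linksAt C a ℕ.+ (suc (code w a) ℕ.+ suc (toℕ a))
      ≡⟨ cong (λ c → linksAt C a ℕ.+ (c ℕ.+ suc (toℕ a))) (code-adjacent-swap-a w a<b b-next) ⟨
    linksAt C a ℕ.+ (code (w · (a , b)) a ℕ.+ suc (toℕ a))
      ≡⟨ greedy-linksAt-code GC a ⟩
    n ∎
  step (no a≢k) = begin
    linksAt ((a , b) ∷ C) k ℕ.+ (code w k ℕ.+ suc (toℕ k))
      ≡⟨ cong (λ xs → length xs ℕ.+ (code w k ℕ.+ suc (toℕ k))) (filter-reject P? {a , b} {C} a≢k) ⟩
    linksAt C k ℕ.+ (code w k ℕ.+ suc (toℕ k))
      ≡⟨ cong (λ c → linksAt C k ℕ.+ (c ℕ.+ suc (toℕ k))) (code-adjacent-swap w a<b b-next (a≢k ∘ sym)) ⟨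
    linksAt C k ℕ.+ (code (w · (a , b)) k ℕ.+ suc (toℕ k))
      ≡⟨ greedy-linksAt-code GC k ⟩
    n ∎

[m+[c+s]]-s-m≡c : ∀ m c s → + (m ℕ.+ (c ℕ.+ s)) - + s - + m ≡ + c
[m+[c+s]]-s-m≡c m c s
  rewrite ℤₚ.pos-+ m (c ℕ.+ s) | ℤₚ.pos-+ c s =
  solve 3 (λ m c s → (m :+ (c :+ s)) :- s :- m := c) refl (+ m) (+ c) (+ s)
  where open +-*-Solver

theorem5p6 : ∀ (n : ℕ) (w : Permutation′ n) → wt (ξ w) ≡ invcode w
theorem5p6 n w = tabulate-cong λ k → let C = greedyLinks w in begin
  + n - + suc (toℕ k) - + linksAt C k
    -- Only the leading n is expanded, so that both integer subtractions cancel against its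
    -- summands.
    ≡⟨ cong (λ x → + x - + suc (toℕ k) - + linksAt C k) (greedy-linksAt-code (greedyLinks-Greedy w) k) ⟨
  + (linksAt C k ℕ.+ (code w k ℕ.+ suc (toℕ k))) - + suc (toℕ k) - + linksAt C k
    ≡⟨ [m+[c+s]]-s-m≡c (linksAt C k) (code w k) (suc (toℕ k)) ⟩
  + code w k
    -- `allFin n` unfolds to `tabulate id`, and `inversion?` to the test used in `invcode`.
    ≡⟨ cong +_ (length-filter-tabulate (inversion? w k) id) ⟨
  + length (filter (inversion? w k) (allFin n))
    ∎
  where open ≡-Reasoning
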